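{- Let $a,c$ be positive integers with $a<c$, and let $b$ be a multiple of $a$ (the formula below does not involve $b$). For integers $k\ge1$ and $s\ge1$, let $A_s(k)$ be the number of lattice paths with unit East steps $(1,0)$ and unit North steps $(0,1)$, starting at $(0,0)$, ending at $(x_s,y_s)=(cs-1,\;as-1)$, and staying strictly below the line $y=\frac ac x+\frac kc$ (i.e. every lattice point $(x,y)$ of the path satisfies $y<\frac ac x+\frac kc$). Then for all $s\ge1$ and all integers $\ell\ge0$ with $(\ell+1)a<c$, $$\sum_{k=\ell a+1}^{(\ell+1)a}A_s(k)=\frac{\ell a+c}{(a+c)s+\ell-1}\binom{(a+c)s+\ell-1}{as-1}.$$ -}

module Defs where

open import Data.Integer.Base using (+_)
open import Data.List.Base
  using (List; []; _∷_; [_]; _++_; map; filter; length; applyUpTo)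
open import Data.List.Membership.Propositional using (_∈_)
open import Data.List.Membership.Propositional.Properties
  using (∈-map⁺; ∈-map⁻; ∈-++⁺ˡ; ∈-++⁺ʳ; ∈-filter⁺; ∈-filter⁻)
open import Data.List.Relation.Unary.All using (All; all?)
open import Data.List.Relation.Unary.Any using (here)
open import Data.List.Relation.Unary.AllPairs using ([]; _∷_)
import Data.List.Relation.Unary.All as All
open import Data.List.Properties using (∷-injectiveʳ)
open import Data.List.Relation.Unary.Unique.Propositional using (Unique)
import Data.List.Relation.Unary.Unique.Propositional.Properties as Unique
open import Data.Nat.Base
  using (ℕ; zero; suc; _+_; _*_; _∸_; _≤_; _<_; NonZero; >-nonZero; >-nonZero⁻¹)
open import Data.Nat.Properties as ℕ
  using (+-suc; +-identityʳ; m≤m+n; m≤n+m; m≤m*n; <-≤-trans; ≤-trans; m<n⇒0<n∸m)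
open import Data.Nat.ListAction using (sum)
open import Data.Product.Base using (_×_; _,_; proj₁; proj₂)
open import Data.Product.Properties using (≡-dec)
open import Data.Rational.Base as ℚ using (ℚ; _/_)
import Data.Rational.Properties as ℚ
open import Function.Bundles using (_⇔_; mk⇔)
open import Relation.Binary.PropositionalEquality
  using (_≡_; refl; sym; trans; cong; subst)
open import Relation.Nullary.Decidable using (Dec; _×-dec_)

Point : Set
Point = ℕ × ℕ

origin : Point
origin = 0 , 0

data Step : Set where
  E N : Step

move : Point → Step → Point
move (x , y) E = suc x , y
move (x , y) N = x , suc y

Path : Set
Path = List Step

-- All lattice points of a path started at p, including p and the endpoint.
points : Point → Path → List Point
points p []      = [ p ]
points p (s ∷ w) = p ∷ points (move p s) w

end : Point → Path → Point
end p []      = p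
end p (s ∷ w) = end (move p s) w

Below : (a c k : ℕ) .{{_ : NonZero c}} → Point → Set
Below a c k (x , y) =
  (+ y / 1) ℚ.< (+ a / c) ℚ.* (+ x / 1) ℚ.+ (+ k / c)

IsPathBelow : (a c k : ℕ) .{{_ : NonZero c}} → Point → Path → Set
IsPathBelow a c k q w =
  end origin w ≡ q × All (Below a c k) (points origin w)

isPathBelow? : (a c k : ℕ) .{{_ : NonZero c}} (q : Point) (w : Path) →
               Dec (IsPathBelow a c k q w)
isPathBelow? a c k q w =
  ≡-dec ℕ._≟_ ℕ._≟_ (end origin w) q
  ×-dec all? (λ _ → _ ℚ.<? _) (points origin w)

words : ℕ → List Path
words zero    = [ [] ]
words (suc n) = map (E ∷_) (words n) ++ map (N ∷_) (words n)

-- A path from the origin to (x , y) has exactly x + y steps, so restricting to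
-- words of that length loses nothing; see ∈-pathsBelow and pathsBelow-unique.
pathsBelow : (a c k : ℕ) .{{_ : NonZero c}} → Point → List Path
pathsBelow a c k (x , y) = filter (isPathBelow? a c k (x , y)) (words (x + y))

A : (a c : ℕ) .{{_ : NonZero c}} (s k : ℕ) → ℕ
A a c s k = length (pathsBelow a c k (c * s ∸ 1 , a * s ∸ 1))

-- The sum of f k over m ≤ k ≤ n.
∑[_⋯_] : (m n : ℕ) → (ℕ → ℕ) → ℕ
∑[ m ⋯ n ] f = sum (applyUpTo (λ i → f (m + i)) (suc n ∸ m))

denominator-nonZero : ∀ a c s ℓ .{{_ : NonZero a}} .{{_ : NonZero s}} →
                      a < c → NonZero ((a + c) * s + ℓ ∸ 1)
denominator-nonZero a@(suc _) c s ℓ a<c = >-nonZero (m<n⇒0<n∸m 1<D)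
  where
  1<D : 1 < (a + c) * s + ℓ
  1<D = <-≤-trans (ℕ.≤-<-trans (>-nonZero⁻¹ a) a<c)
          (≤-trans (m≤n+m c a)
            (≤-trans (m≤m*n (a + c) s) (m≤m+n ((a + c) * s) ℓ)))

∈-words : ∀ w → w ∈ words (length w)
∈-words []      = here refl
∈-words (E ∷ w) = ∈-++⁺ˡ (∈-map⁺ (E ∷_) (∈-words w))
∈-words (N ∷ w) = ∈-++⁺ʳ (map (E ∷_) (words (length w))) (∈-map⁺ (N ∷_) (∈-words w))

words-unique : ∀ n → Unique (words n)
words-unique zero    = All.[] ∷ []
words-unique (suc n) =
  Unique.++⁺ (Unique.map⁺ ∷-injectiveʳ (words-unique n))
             (Unique.map⁺ ∷-injectiveʳ (words-unique n)) disjoint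
  where
  disjoint : ∀ {w} → w ∈ map (E ∷_) (words n) × w ∈ map (N ∷_) (words n) → _
  disjoint (p , q) with ∈-map⁻ (E ∷_) p | ∈-map⁻ (N ∷_) q
  ... | _ , _ , refl | _ , _ , ()

length-end : ∀ x y w → let (x′ , y′) = end (x , y) w in x + y + length w ≡ x′ + y′
length-end x y []      = +-identityʳ (x + y)
length-end x y (E ∷ w) = trans (+-suc (x + y) (length w)) (length-end (suc x) y w)
length-end x y (N ∷ w) =
  trans (+-suc (x + y) (length w))
        (trans (cong (_+ length w) (sym (+-suc x y))) (length-end x (suc y) w))

∈-pathsBelow : ∀ a c k .{{_ : NonZero c}} q w →
               w ∈ pathsBelow a c k q ⇔ IsPathBelow a c k q w
∈-pathsBelow a c k q@(x , y) w = mk⇔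
  (λ i → proj₂ (∈-filter⁻ (isPathBelow? a c k q) {xs = words (x + y)} i))
  (λ p → ∈-filter⁺ (isPathBelow? a c k q)
           (subst (λ n → w ∈ words n)
                  (trans (length-end 0 0 w) (cong (λ r → proj₁ r + proj₂ r) (proj₁ p)))
                  (∈-words w))
           p)

pathsBelow-unique : ∀ a c k .{{_ : NonZero c}} q → Unique (pathsBelow a c k q)
pathsBelow-unique a c k q@(x , y) =
  Unique.filter⁺ (isPathBelow? a c k q) (words-unique (x + y))

{-# OPTIONS --safe #-}
module Submission where

-- Weigh East by −a and North by c, so that c y − a x is the partial sum and a path w
-- counts for k exactly when its maximum h(w) ≥ 0 is below k.  Summing over the given a
-- values of k counts w with weight a ∸ (h(w) ∸ ℓ a), which is the gap
-- a ∸ h(Eˡ w) of w preceded by ℓ East steps; words not of the form Eˡ w have gap 0.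
-- Hence the left side is the sum of a ∸ h(v) over all words v with p = a s − 1 North
-- and c s + ℓ − 1 East steps.  It is evaluated by a cycle-lemma argument on the words
-- with one East step more, whose total −(ℓ a + c) is negative: the last step of such a
-- word v′ x does not affect its maximum, so the sum of h over these words is also the
-- sum of h(v′), while splitting off the first step x v gives h(N v) = h(v) + c and
-- h(E v) = h(v) − a + (a ∸ h(v)).  The heights cancel, and the gaps add up to a times
-- the number of words starting with E minus c times the number starting with N.

open import Defs
open import Algebra.Properties.CommutativeSemigroup using (interchange)
open import Data.Bool.Base using (Bool; true; false; _∧_)
open import Data.Integer.Base using (ℤ; +_)
import Data.Integer.Base as ℤ
import Data.Integer.Properties as ℤ
open import Data.Integer.Divisibility using (_∣_)
open import Data.Integer.Tactic.RingSolver as ℤ-Ring using ()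
open import Data.List.Base using ([]; _∷_; _++_; map; filter; length; applyUpTo; _∷ʳ_)
open import Data.List.Properties using (map-++; map-∘)
open import Data.List.Relation.Unary.All using (All; []; _∷_)
open import Data.Nat.Base using (ℕ; zero; suc; _+_; _*_; _∸_; _⊔_; _≤_; _<_; >-nonZero⁻¹; NonZero)
open import Data.Nat.Combinatorics using (_C_; nCk+nC[k+1]≡[n+1]C[k+1]; nC1≡n)
open import Data.Nat.ListAction using (sum)
open import Data.Nat.ListAction.Properties using (sum-++)
open import Data.Nat.Properties
open import Data.Nat.Tactic.RingSolver using (solve-∀)
open import Data.Product.Base using (_×_; _,_; proj₂)
open import Data.Sum.Base using (inj₁; inj₂)
open import Data.Rational.Base as ℚ using (_/_; toℚᵘ)
import Data.Rational.Properties as ℚ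
open import Data.Rational.Unnormalised.Base as ℚᵘ using (mkℚᵘ; *≡*; *<*)
import Data.Rational.Unnormalised.Properties as ℚᵘ
open import Function.Base using (_∘_)
open import Function.Bundles using (_⇔_; mk⇔; Equivalence)
open import Relation.Binary.PropositionalEquality
  using (_≡_; refl; sym; trans; cong; cong₂; subst; subst₂; module ≡-Reasoning)
open import Relation.Nullary.Decidable using (Dec; yes; no; does; does-⇔; dec-true; dec-false; _×-dec_)

-- Binomial absorption and truncated subtraction

[1+k]*[1+n]C[1+k]≡[1+n]*nCk : ∀ n k → suc k * (suc n C suc k) ≡ suc n * (n C k)
[1+k]*[1+n]C[1+k]≡[1+n]*nCk zero zero = refl
[1+k]*[1+n]C[1+k]≡[1+n]*nCk zero (suc k) = *-zeroʳ k
[1+k]*[1+n]C[1+k]≡[1+n]*nCk (suc n) zero = begin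
  1 * (suc (suc n) C 1)   ≡⟨ *-identityˡ _ ⟩
  suc (suc n) C 1         ≡⟨ nC1≡n (suc (suc n)) ⟩
  suc (suc n)             ≡⟨ *-identityʳ _ ⟨
  suc (suc n) * 1         ∎
  where open ≡-Reasoning
[1+k]*[1+n]C[1+k]≡[1+n]*nCk (suc n) (suc k) = begin
  (2 + k) * (suc (suc n) C suc (suc k))
    ≡⟨ cong ((2 + k) *_) (nCk+nC[k+1]≡[n+1]C[k+1] (suc n) (suc k)) ⟨
  (2 + k) * (u + (suc n C suc (suc k)))
    ≡⟨ distrib k u (suc n C suc (suc k)) ⟩
  u + (suc k * u + (2 + k) * (suc n C suc (suc k)))
    ≡⟨ cong (λ z → u + z) (cong₂ _+_ ([1+k]*[1+n]C[1+k]≡[1+n]*nCk n k)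
                              ([1+k]*[1+n]C[1+k]≡[1+n]*nCk n (suc k))) ⟩
  u + (suc n * (n C k) + suc n * (n C suc k))
    ≡⟨ cong (λ z → u + z) (*-distribˡ-+ (suc n) (n C k) (n C suc k)) ⟨
  u + suc n * (n C k + n C suc k)
    ≡⟨ cong (λ z → u + suc n * z) (nCk+nC[k+1]≡[n+1]C[k+1] n k) ⟩
  (2 + n) * u ∎
  where
  open ≡-Reasoning
  u = suc n C suc k
  distrib : ∀ k u v → (2 + k) * (u + v) ≡ u + (suc k * u + (2 + k) * v)
  distrib = solve-∀

m∸n+n≡m⊔n : ∀ m n → m ∸ n + n ≡ m ⊔ n
m∸n+n≡m⊔n m       zero    = trans (+-identityʳ m) (sym (⊔-identityʳ m))
m∸n+n≡m⊔n zero    (suc n) = refl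
m∸n+n≡m⊔n (suc m) (suc n) = trans (+-suc (m ∸ n) n) (cong suc (m∸n+n≡m⊔n m n))

-- Sums over all words of a given length

-- The recursion is on the first letter, so that splitting a sum there is definitional.
∑ʷ : ℕ → (Path → ℕ) → ℕ
∑ʷ zero    f = f []
∑ʷ (suc n) f = ∑ʷ n (f ∘ (E ∷_)) + ∑ʷ n (f ∘ (N ∷_))

∑ʷ-cong-length : ∀ n {f g : Path → ℕ} → (∀ w → length w ≡ n → f w ≡ g w) → ∑ʷ n f ≡ ∑ʷ n g
∑ʷ-cong-length zero    eq = eq [] refl
∑ʷ-cong-length (suc n) eq =
  cong₂ _+_ (∑ʷ-cong-length n λ w l → eq (E ∷ w) (cong suc l))
            (∑ʷ-cong-length n λ w l → eq (N ∷ w) (cong suc l))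

∑ʷ-cong : ∀ n {f g : Path → ℕ} → (∀ w → f w ≡ g w) → ∑ʷ n f ≡ ∑ʷ n g
∑ʷ-cong n eq = ∑ʷ-cong-length n λ w _ → eq w

∑ʷ-zero : ∀ n → ∑ʷ n (λ _ → 0) ≡ 0
∑ʷ-zero zero    = refl
∑ʷ-zero (suc n) = cong₂ _+_ (∑ʷ-zero n) (∑ʷ-zero n)

∑ʷ-distrib-+ : ∀ n (f g : Path → ℕ) → ∑ʷ n (λ w → f w + g w) ≡ ∑ʷ n f + ∑ʷ n g
∑ʷ-distrib-+ zero    f g = refl
∑ʷ-distrib-+ (suc n) f g =
  trans (cong₂ _+_ (∑ʷ-distrib-+ n _ _) (∑ʷ-distrib-+ n _ _))
        (interchange +-commutativeSemigroup (∑ʷ n (f ∘ (E ∷_))) _ _ _)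

∑ʷ-distribʳ-* : ∀ n k (f : Path → ℕ) → ∑ʷ n (λ w → f w * k) ≡ k * ∑ʷ n f
∑ʷ-distribʳ-* zero    k f = *-comm (f []) k
∑ʷ-distribʳ-* (suc n) k f =
  trans (cong₂ _+_ (∑ʷ-distribʳ-* n k _) (∑ʷ-distribʳ-* n k _))
        (sym (*-distribˡ-+ k (∑ʷ n (f ∘ (E ∷_))) _))

∑ʷ-∷ʳ : ∀ n (f : Path → ℕ) → ∑ʷ (suc n) f ≡ ∑ʷ n (f ∘ (_∷ʳ E)) + ∑ʷ n (f ∘ (_∷ʳ N))
∑ʷ-∷ʳ zero    f = refl
∑ʷ-∷ʳ (suc n) f =
  trans (cong₂ _+_ (∑ʷ-∷ʳ n (f ∘ (E ∷_))) (∑ʷ-∷ʳ n (f ∘ (N ∷_))))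
        (interchange +-commutativeSemigroup (∑ʷ n (λ w → f (E ∷ w ∷ʳ E))) _ _ _)

sum-map-words : ∀ n (f : Path → ℕ) → sum (map f (words n)) ≡ ∑ʷ n f
sum-map-words zero    f = +-identityʳ (f [])
sum-map-words (suc n) f = begin
  sum (map f (map (E ∷_) (words n) ++ map (N ∷_) (words n)))
    ≡⟨ cong sum (map-++ f (map (E ∷_) (words n)) _) ⟩
  sum (map f (map (E ∷_) (words n)) ++ map f (map (N ∷_) (words n)))
    ≡⟨ sum-++ (map f (map (E ∷_) (words n))) _ ⟩
  sum (map f (map (E ∷_) (words n))) + sum (map f (map (N ∷_) (words n)))
    ≡⟨ cong₂ _+_ (cong sum (map-∘ (words n))) (cong sum (map-∘ (words n))) ⟨
  sum (map (f ∘ (E ∷_)) (words n)) + sum (map (f ∘ (N ∷_)) (words n))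
    ≡⟨ cong₂ _+_ (sum-map-words n _) (sum-map-words n _) ⟩
  ∑ʷ (suc n) f ∎
  where open ≡-Reasoning

-- Finite sums and counting with indicators

sum-applyUpTo-cong : ∀ n {f g : ℕ → ℕ} → (∀ i → f i ≡ g i) →
                     sum (applyUpTo f n) ≡ sum (applyUpTo g n)
sum-applyUpTo-cong zero    eq = refl
sum-applyUpTo-cong (suc n) eq = cong₂ _+_ (eq 0) (sum-applyUpTo-cong n (eq ∘ suc))

sum-applyUpTo-*ˡ : ∀ n k (f : ℕ → ℕ) →
                   sum (applyUpTo (λ i → k * f i) n) ≡ k * sum (applyUpTo f n)
sum-applyUpTo-*ˡ zero    k f = sym (*-zeroʳ k)
sum-applyUpTo-*ˡ (suc n) k f =
  trans (cong (λ z → k * f 0 + z) (sum-applyUpTo-*ˡ n k (f ∘ suc))) (sym (*-distribˡ-+ k (f 0) _))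

sum-applyUpTo-∑ʷ : ∀ n L (f : ℕ → Path → ℕ) →
                   sum (applyUpTo (λ i → ∑ʷ L (f i)) n) ≡ ∑ʷ L (λ w → sum (applyUpTo (λ i → f i w) n))
sum-applyUpTo-∑ʷ zero    L f = sym (∑ʷ-zero L)
sum-applyUpTo-∑ʷ (suc n) L f =
  trans (cong (λ z → ∑ʷ L (f 0) + z) (sum-applyUpTo-∑ʷ n L (f ∘ suc)))
        (sym (∑ʷ-distrib-+ L (f 0) _))

⟦_⟧ : Bool → ℕ
⟦ false ⟧ = 0
⟦ true  ⟧ = 1

⟦⟧-∧ : ∀ x y → ⟦ x ∧ y ⟧ ≡ ⟦ x ⟧ * ⟦ y ⟧
⟦⟧-∧ false y = refl
⟦⟧-∧ true  y = sym (+-identityʳ ⟦ y ⟧)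

length-filter≡sum : ∀ {P : Path → Set} (P? : ∀ w → Dec (P w)) ws →
                    length (filter P? ws) ≡ sum (map (λ w → ⟦ does (P? w) ⟧) ws)
length-filter≡sum P? []       = refl
length-filter≡sum P? (w ∷ ws) with does (P? w)
... | false = length-filter≡sum P? ws
... | true  = cong suc (length-filter≡sum P? ws)

-- The values `m + i` that are at most `h` are the first `suc h ∸ m` of them, or all `n` if there
-- are fewer; truncation covers both extremes.
count-bounds : ∀ h m n → sum (applyUpTo (λ i → ⟦ does (h <? m + i) ⟧) n) ≡ n ∸ (suc h ∸ m)
count-bounds h m zero    = sym (0∸n≡0 (suc h ∸ m))
count-bounds h m (suc n) = trans (cong₂ _+_ (cong (λ k → ⟦ does (h <? k) ⟧) (+-identityʳ m)) tail) step
  where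
  tail : sum (applyUpTo (λ i → ⟦ does (h <? m + suc i) ⟧) n) ≡ n ∸ (h ∸ m)
  tail = trans (sum-applyUpTo-cong n λ i → cong (λ k → ⟦ does (h <? k) ⟧) (+-suc m i))
               (count-bounds h (suc m) n)
  step : ⟦ does (h <? m) ⟧ + (n ∸ (h ∸ m)) ≡ suc n ∸ (suc h ∸ m)
  step with h <? m
  ... | yes h<m = begin
    ⟦ does (h <? m) ⟧ + (n ∸ (h ∸ m)) ≡⟨ cong₂ (λ b z → ⟦ b ⟧ + (n ∸ z)) (dec-true (h <? m) h<m)
                                                (m≤n⇒m∸n≡0 (<⇒≤ h<m)) ⟩
    suc n                             ≡⟨ cong (λ z → suc n ∸ z) (m≤n⇒m∸n≡0 h<m) ⟨
    suc n ∸ (suc h ∸ m)               ∎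
    where open ≡-Reasoning
  ... | no  h≮m = begin
    ⟦ does (h <? m) ⟧ + (n ∸ (h ∸ m)) ≡⟨ cong (λ b → ⟦ b ⟧ + (n ∸ (h ∸ m))) (dec-false (h <? m) h≮m) ⟩
    suc n ∸ suc (h ∸ m)               ≡⟨ cong (λ z → suc n ∸ z) (+-∸-assoc 1 (≮⇒≥ h≮m)) ⟨
    suc n ∸ (suc h ∸ m)               ∎
    where open ≡-Reasoning

-- Words with a given number of North steps

norths easts : Path → ℕ
norths []      = 0
norths (E ∷ w) = norths w
norths (N ∷ w) = suc (norths w)
easts []      = 0
easts (E ∷ w) = suc (easts w)
easts (N ∷ w) = easts w

easts+norths≡length : ∀ w → easts w + norths w ≡ length w
easts+norths≡length []      = refl
easts+norths≡length (E ∷ w) = cong suc (easts+norths≡length w)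
easts+norths≡length (N ∷ w) =
  trans (+-suc (easts w) (norths w)) (cong suc (easts+norths≡length w))

norths-∷ʳE : ∀ w → norths (w ∷ʳ E) ≡ norths w
norths-∷ʳE []      = refl
norths-∷ʳE (E ∷ w) = norths-∷ʳE w
norths-∷ʳE (N ∷ w) = cong suc (norths-∷ʳE w)

norths-∷ʳN : ∀ w → norths (w ∷ʳ N) ≡ suc (norths w)
norths-∷ʳN []      = refl
norths-∷ʳN (E ∷ w) = norths-∷ʳN w
norths-∷ʳN (N ∷ w) = cong suc (norths-∷ʳN w)

end-coordinates : ∀ x y w → end (x , y) w ≡ (x + easts w , y + norths w)
end-coordinates x y []      = cong₂ _,_ (sym (+-identityʳ x)) (sym (+-identityʳ y))
end-coordinates x y (E ∷ w) =
  trans (end-coordinates (suc x) y w) (cong (_, y + norths w) (sym (+-suc x (easts w))))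
end-coordinates x y (N ∷ w) =
  trans (end-coordinates x (suc y) w) (cong (x + easts w ,_) (sym (+-suc y (norths w))))

χ : ℕ → Path → ℕ
χ p w = ⟦ does (norths w ≟ p) ⟧

χN χE : ℕ → Path → ℕ
χE p w = χ p (E ∷ w)
χN p w = χ p (N ∷ w)

∑ʷ-χ : ∀ n p → ∑ʷ n (χ p) ≡ n C p
∑ʷ-χ zero    zero    = refl
∑ʷ-χ zero    (suc p) = refl
∑ʷ-χ (suc n) zero    = cong₂ _+_ (∑ʷ-χ n 0) (∑ʷ-zero n)
∑ʷ-χ (suc n) (suc p) = begin
  ∑ʷ n (χ (suc p)) + ∑ʷ n (χ p) ≡⟨ cong₂ _+_ (∑ʷ-χ n (suc p)) (∑ʷ-χ n p) ⟩
  n C suc p + n C p             ≡⟨ +-comm (n C suc p) (n C p) ⟩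
  n C p + n C suc p             ≡⟨ nCk+nC[k+1]≡[n+1]C[k+1] n p ⟩
  suc n C suc p                 ∎
  where open ≡-Reasoning

-- Both sides count words with a marked North step, since each of the `suc n` positions carries N
-- equally often; the proof is by absorption.
p*∑χ≡[1+n]*∑χN : ∀ n p → p * ∑ʷ (suc n) (χ p) ≡ suc n * ∑ʷ n (χN p)
p*∑χ≡[1+n]*∑χN n zero    = sym (trans (cong (suc n *_) (∑ʷ-zero n)) (*-zeroʳ (suc n)))
p*∑χ≡[1+n]*∑χN n (suc p) = begin
  suc p * ∑ʷ (suc n) (χ (suc p)) ≡⟨ cong (suc p *_) (∑ʷ-χ (suc n) (suc p)) ⟩
  suc p * (suc n C suc p)        ≡⟨ [1+k]*[1+n]C[1+k]≡[1+n]*nCk n p ⟩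
  suc n * (n C p)                ≡⟨ cong (suc n *_) (∑ʷ-χ n p) ⟨
  suc n * ∑ʷ n (χ p)             ∎
  where open ≡-Reasoning

q*∑χ≡[1+n]*∑χE : ∀ n p q → p + q ≡ suc n → q * ∑ʷ (suc n) (χ p) ≡ suc n * ∑ʷ n (χE p)
q*∑χ≡[1+n]*∑χE n p q p+q≡1+n = +-cancelˡ-≡ (p * X) _ _ (begin
  p * X + q * X                 ≡⟨ *-distribʳ-+ X p q ⟨
  (p + q) * X                   ≡⟨ cong (_* X) p+q≡1+n ⟩
  suc n * (Y + Z)               ≡⟨ *-distribˡ-+ (suc n) Y Z ⟩
  suc n * Y + suc n * Z         ≡⟨ +-comm (suc n * Y) (suc n * Z) ⟩
  suc n * Z + suc n * Y         ≡⟨ cong (_+ suc n * Y) (p*∑χ≡[1+n]*∑χN n p) ⟨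
  p * X + suc n * Y             ∎)
  where
  open ≡-Reasoning
  X = ∑ʷ (suc n) (χ p)
  Y = ∑ʷ n (χE p)
  Z = ∑ʷ n (χN p)

-- Heights and the cycle-lemma argument

module _ (a c : ℕ) where

  -- height 0 w is the maximum of c y − a x over the points (x , y) of w started
  -- at the origin; height t w is the same with t in place of the last 0, that is,
  -- the maximum with the final value raised by t.
  height : ℕ → Path → ℕ
  height t []      = t
  height t (E ∷ w) = height t w ∸ a
  height t (N ∷ w) = height t w + c

  -- `height` recurses from the front, so an appended step acts only on the terminal value.
  height-∷ʳE : ∀ t w → height t (w ∷ʳ E) ≡ height (t ∸ a) w
  height-∷ʳE t []      = refl
  height-∷ʳE t (E ∷ w) = cong (_∸ a) (height-∷ʳE t w)
  height-∷ʳE t (N ∷ w) = cong (_+ c) (height-∷ʳE t w)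

  height-∷ʳN : ∀ t w → height t (w ∷ʳ N) ≡ height (t + c) w
  height-∷ʳN t []      = refl
  height-∷ʳN t (E ∷ w) = cong (_∸ a) (height-∷ʳN t w)
  height-∷ʳN t (N ∷ w) = cong (_+ c) (height-∷ʳN t w)

  -- height t w = height 0 w ⊔ (t + c n − a e), with a e moved to the left.
  height-⊔ : ∀ t w → height t w + a * easts w ≡ (height 0 w + a * easts w) ⊔ (t + c * norths w)
  height-⊔ t [] rewrite *-zeroʳ a | *-zeroʳ c = refl
  height-⊔ t (E ∷ w) = begin
    (h ∸ a) + a * suc e     ≡⟨ shift h ⟩
    a * suc e ⊔ (h + a * e) ≡⟨ cong (a * suc e ⊔_) (height-⊔ t w) ⟩
    a * suc e ⊔ ((h₀ + a * e) ⊔ r) ≡⟨ ⊔-assoc (a * suc e) (h₀ + a * e) r ⟨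
    (a * suc e ⊔ (h₀ + a * e)) ⊔ r ≡⟨ cong (_⊔ r) (shift h₀) ⟨
    ((h₀ ∸ a) + a * suc e) ⊔ r ∎
    where
    open ≡-Reasoning
    h = height t w
    h₀ = height 0 w
    e = easts w
    r = t + c * norths w
    shift : ∀ h → (h ∸ a) + a * suc e ≡ a * suc e ⊔ (h + a * e)
    shift h = begin
      (h ∸ a) + a * suc e     ≡⟨ cong (λ z → (h ∸ a) + z) (*-suc a e) ⟩
      (h ∸ a) + (a + a * e)   ≡⟨ +-assoc (h ∸ a) a (a * e) ⟨
      (h ∸ a) + a + a * e     ≡⟨ cong (_+ a * e) (m∸n+n≡m⊔n h a) ⟩
      (h ⊔ a) + a * e         ≡⟨ +-distribʳ-⊔ (a * e) h a ⟩
      (h + a * e) ⊔ (a + a * e) ≡⟨ ⊔-comm (h + a * e) (a + a * e) ⟩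
      (a + a * e) ⊔ (h + a * e) ≡⟨ cong (_⊔ (h + a * e)) (*-suc a e) ⟨
      a * suc e ⊔ (h + a * e) ∎
  height-⊔ t (N ∷ w) = begin
    h + c + a * e       ≡⟨ swap h c (a * e) ⟩
    h + a * e + c       ≡⟨ cong (_+ c) (height-⊔ t w) ⟩
    ((h₀ + a * e) ⊔ (t + c * norths w)) + c ≡⟨ +-distribʳ-⊔ c (h₀ + a * e) _ ⟩
    (h₀ + a * e + c) ⊔ (t + c * norths w + c) ≡⟨ cong₂ _⊔_ (swap h₀ (a * e) c) (unfold t c (norths w)) ⟩
    (h₀ + c + a * e) ⊔ (t + c * suc (norths w)) ∎
    where
    open ≡-Reasoning
    h = height t w
    h₀ = height 0 w
    e = easts w
    swap : ∀ x y z → x + y + z ≡ x + z + y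
    swap = solve-∀
    unfold : ∀ t c n → t + c * n + c ≡ t + c * suc n
    unfold = solve-∀

  -- The starting point already contributes 0 to the maximum, so a raised final value that is still
  -- at most 0 cannot change it.
  height-final : ∀ t w → t + c * norths w ≤ a * easts w → height t w ≡ height 0 w
  height-final t w le = +-cancelʳ-≡ (a * easts w) _ _
    (trans (height-⊔ t w) (m≥n⇒m⊔n≡m (≤-trans le (m≤n+m _ (height 0 w)))))

  -- Rotating a word of nonpositive total moves its first step to the end without
  -- affecting the maximum over the remaining points; so the heights of all words,
  -- summed by first letter and by last letter, differ only through that step.
  ∑ʷ-rotation : ∀ n p q → p + q ≡ suc n → c * p ≤ a * q →
    ∑ʷ n (λ w → χE p w * (height 0 w ∸ a)) + ∑ʷ n (λ w → χN p w * (height 0 w + c))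
    ≡ ∑ʷ n (λ w → χE p w * height 0 w) + ∑ʷ n (λ w → χN p w * height 0 w)
  ∑ʷ-rotation n p q p+q≡1+n cp≤aq =
    -- The left side is by definition the height sum over words of length `suc n`, split by first
    -- letter.
    trans (∑ʷ-∷ʳ n (λ w → χ p w * height 0 w)) (cong₂ _+_
      (∑ʷ-cong n λ w → cong₂ _*_
        (cong (λ m → ⟦ does (m ≟ p) ⟧) (norths-∷ʳE w))
        -- A final E replaces the terminal value 0 by `0 ∸ a`, which is again 0.
        (trans (height-∷ʳE 0 w) (cong (λ t → height t w) (0∸n≡0 a))))
      (∑ʷ-cong-length n λ w l →
        trans (cong₂ _*_ (cong (λ m → ⟦ does (m ≟ p) ⟧) (norths-∷ʳN w)) (height-∷ʳN 0 w))
              (lastN w l)))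
    where
    lastN : ∀ w → length w ≡ n → χN p w * height c w ≡ χN p w * height 0 w
    lastN w l with suc (norths w) ≟ p
    ... | no  n≢p  = trans (cong (_* height c w) χN≡0) (cong (_* height 0 w) (sym χN≡0))
      where
      χN≡0 : χN p w ≡ 0
      χN≡0 = cong ⟦_⟧ (dec-false (suc (norths w) ≟ p) n≢p)
    -- Here `w` followed by N has `p` North and `q` East steps, so its total is nonpositive.
    ... | yes refl = cong (χN p w *_) (height-final c w (begin
      c + c * norths w   ≡⟨ *-suc c (norths w) ⟨
      c * suc (norths w) ≤⟨ cp≤aq ⟩
      a * q              ≡⟨ cong (a *_) q≡easts ⟩
      a * easts w        ∎))
      where
      open ≤-Reasoning
      q≡easts : q ≡ easts w
      q≡easts = +-cancelˡ-≡ (norths w) _ _ (suc-injective (trans p+q≡1+n (cong suc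
        (trans (sym l) (trans (sym (easts+norths≡length w)) (+-comm (easts w) (norths w)))))))

  -- An initial E lowers the height by `a` less the gap, an initial N raises it by `c`; by
  -- `∑ʷ-rotation` these changes sum to zero.
  ∑ʷ-gap : ∀ n p q → p + q ≡ suc n → c * p ≤ a * q →
    ∑ʷ n (λ w → χ p w * (a ∸ height 0 w)) + c * ∑ʷ n (χN p) ≡ a * ∑ʷ n (χE p)
  -- Adding `K` to both sides avoids subtracting truncated differences.
  ∑ʷ-gap n p q p+q≡1+n cp≤aq = +-cancelˡ-≡ K _ _ (begin
    K + (S + c * Z)   ≡⟨ rearrange K S (c * Z) ⟩
    S + (K + c * Z)   ≡⟨ cong (λ z → S + z) K+cZ≡H ⟩
    -- `χE p w` reduces to `χ p w`, which lets the two sums merge.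
    S + H             ≡⟨ ∑ʷ-distrib-+ n _ _ ⟨
    ∑ʷ n (λ w → χE p w * (a ∸ height 0 w) + χE p w * height 0 w)
      ≡⟨ ∑ʷ-cong n (λ w → trade (χE p w) (height 0 w)) ⟩
    ∑ʷ n (λ w → χE p w * (height 0 w ∸ a) + χE p w * a)
      ≡⟨ ∑ʷ-distrib-+ n _ _ ⟩
    K + ∑ʷ n (λ w → χE p w * a) ≡⟨ cong (λ z → K + z) (∑ʷ-distribʳ-* n a (χE p)) ⟩
    K + a * Y ∎)
    where
    open ≡-Reasoning
    S = ∑ʷ n (λ w → χ p w * (a ∸ height 0 w))
    K = ∑ʷ n (λ w → χE p w * (height 0 w ∸ a))
    H = ∑ʷ n (λ w → χE p w * height 0 w)
    G = ∑ʷ n (λ w → χN p w * height 0 w)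
    Y = ∑ʷ n (χE p)
    Z = ∑ʷ n (χN p)
    rearrange : ∀ x y z → x + (y + z) ≡ y + (x + z)
    rearrange = solve-∀
    trade : ∀ u h → u * (a ∸ h) + u * h ≡ u * (h ∸ a) + u * a
    trade u h = begin
      u * (a ∸ h) + u * h ≡⟨ *-distribˡ-+ u (a ∸ h) h ⟨
      u * (a ∸ h + h)     ≡⟨ cong (u *_) (m∸n+n≡m⊔n a h) ⟩
      u * (a ⊔ h)         ≡⟨ cong (u *_) (⊔-comm a h) ⟩
      u * (h ⊔ a)         ≡⟨ cong (u *_) (m∸n+n≡m⊔n h a) ⟨
      u * (h ∸ a + a)     ≡⟨ *-distribˡ-+ u (h ∸ a) a ⟩
      u * (h ∸ a) + u * a ∎
    K+cZ≡H : K + c * Z ≡ H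
    K+cZ≡H = +-cancelʳ-≡ G _ _ (begin
      K + c * Z + G     ≡⟨ trans (+-assoc K (c * Z) G) (cong (λ z → K + z) (+-comm (c * Z) G)) ⟩
      K + (G + c * Z)   ≡⟨ cong (λ z → K + (G + z)) (∑ʷ-distribʳ-* n c (χN p)) ⟨
      K + (G + ∑ʷ n (λ w → χN p w * c)) ≡⟨ cong (λ z → K + z) (∑ʷ-distrib-+ n _ _) ⟨
      K + ∑ʷ n (λ w → χN p w * height 0 w + χN p w * c)
        ≡⟨ cong (λ z → K + z) (∑ʷ-cong n λ w → *-distribˡ-+ (χN p w) (height 0 w) c) ⟨
      K + ∑ʷ n (λ w → χN p w * (height 0 w + c)) ≡⟨ ∑ʷ-rotation n p q p+q≡1+n cp≤aq ⟩
      H + G ∎)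

  -- Multiplication by `suc n` turns the counts by first letter into `p` and `q` times the count of
  -- all words, leaving the difference of `a * q` and `c * p`.
  [1+n]*∑ʷ-gap : ∀ n p q T → p + q ≡ suc n → a * q ≡ c * p + T →
    suc n * ∑ʷ n (λ w → χ p w * (a ∸ height 0 w)) ≡ T * (suc n C p)
  [1+n]*∑ʷ-gap n p q T p+q≡1+n aq≡cp+T = +-cancelʳ-≡ (c * (p * X)) _ _ (begin
    suc n * S + c * (p * X)     ≡⟨ cong (λ z → suc n * S + c * z) (p*∑χ≡[1+n]*∑χN n p) ⟩
    suc n * S + c * (suc n * Z) ≡⟨ factor (suc n) S c Z ⟩
    suc n * (S + c * Z)         ≡⟨ cong (suc n *_) (∑ʷ-gap n p q p+q≡1+n cp≤aq) ⟩
    suc n * (a * Y)             ≡⟨ swap (suc n) a Y ⟩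
    a * (suc n * Y)             ≡⟨ cong (a *_) (q*∑χ≡[1+n]*∑χE n p q p+q≡1+n) ⟨
    a * (q * X)                 ≡⟨ *-assoc a q X ⟨
    a * q * X                   ≡⟨ cong (_* X) aq≡cp+T ⟩
    (c * p + T) * X             ≡⟨ expand c p T X ⟩
    T * X + c * (p * X)         ≡⟨ cong (λ z → T * z + c * (p * X)) (∑ʷ-χ (suc n) p) ⟩
    T * (suc n C p) + c * (p * X) ∎)
    where
    open ≡-Reasoning
    S = ∑ʷ n (λ w → χ p w * (a ∸ height 0 w))
    X = ∑ʷ (suc n) (χ p)
    Y = ∑ʷ n (χE p)
    Z = ∑ʷ n (χN p)
    cp≤aq : c * p ≤ a * q
    cp≤aq = subst (c * p ≤_) (sym aq≡cp+T) (m≤m+n (c * p) T)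
    factor : ∀ d s c z → d * s + c * (d * z) ≡ d * (s + c * z)
    factor = solve-∀
    swap : ∀ d a y → d * (a * y) ≡ a * (d * y)
    swap = solve-∀
    expand : ∀ c p t x → (c * p + t) * x ≡ t * x + c * (p * x)
    expand = solve-∀

  -- Prefixing East steps: a word with a North step among these has gap 0, because c
  -- exceeds what fewer than c / a East steps can compensate.
  ∑ʷ-prepend-E : ∀ ℓ L p → ℓ * a ≤ c →
    ∑ʷ L (λ w → χ p w * (a ∸ (height 0 w ∸ ℓ * a))) ≡ ∑ʷ (ℓ + L) (λ w → χ p w * (a ∸ height 0 w))
  ∑ʷ-prepend-E zero    L p _  = refl
  ∑ʷ-prepend-E (suc ℓ) L p le = begin
    ∑ʷ L (λ w → χ p w * (a ∸ (height 0 w ∸ (a + ℓ * a))))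
      ≡⟨ ∑ʷ-cong L (λ w → cong (λ z → χ p w * (a ∸ z)) (∸-+-assoc (height 0 w) a (ℓ * a))) ⟨
    ∑ʷ L (f ∘ (E ∷_))     ≡⟨ +-identityʳ _ ⟨
    -- The added zero is the sum over words beginning with N, so that the induction hypothesis
    -- applies at length `suc L`.
    ∑ʷ L (f ∘ (E ∷_)) + 0 ≡⟨ cong (λ z → ∑ʷ L (f ∘ (E ∷_)) + z) (trans (∑ʷ-cong L vanish) (∑ʷ-zero L)) ⟨
    ∑ʷ (suc L) f          ≡⟨ ∑ʷ-prepend-E ℓ (suc L) p (≤-trans (m≤n+m (ℓ * a) a) le) ⟩
    ∑ʷ (ℓ + suc L) g      ≡⟨ cong (λ m → ∑ʷ m g) (+-suc ℓ L) ⟩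
    ∑ʷ (suc ℓ + L) g      ∎
    where
    open ≡-Reasoning
    f g : Path → ℕ
    f w = χ p w * (a ∸ (height 0 w ∸ ℓ * a))
    g w = χ p w * (a ∸ height 0 w)
    vanish : ∀ w → f (N ∷ w) ≡ 0
    -- As `a + ℓ * a ≤ c`, the height after an initial N exceeds `ℓ * a` by at least `a`.
    vanish w = trans (cong (χN p w *_) (m≤n⇒m∸n≡0
                 (m+n≤o⇒m≤o∸n a (≤-trans le (m≤n+m c (height 0 w))))))
               (*-zeroʳ (χN p w))

-- Clearing denominators

-- Unnormalised rationals keep numerators and denominators explicit, so cross-multiplication reduces
-- the comparison to integers.
Below⇔ : ∀ a c k .{{_ : NonZero c}} x y → Below a c k (x , y) ⇔ c * y < a * x + k
Below⇔ a c@(suc c-1) k x y = mk⇔ to from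
  where
  lhs : toℚᵘ (+ y / 1) ℚᵘ.≃ mkℚᵘ (+ y) 0
  lhs = ℚ.toℚᵘ-fromℚᵘ (mkℚᵘ (+ y) 0)

  frac : mkℚᵘ (+ a) c-1 ℚᵘ.* mkℚᵘ (+ x) 0 ℚᵘ.+ mkℚᵘ (+ k) c-1 ℚᵘ.≃ mkℚᵘ (+ (a * x + k)) c-1
  frac = *≡* (begin
    (+ a ℤ.* + x ℤ.* + c ℤ.+ + k ℤ.* + (c * 1)) ℤ.* + c
      ≡⟨ cong (λ d → (+ a ℤ.* + x ℤ.* + c ℤ.+ + k ℤ.* + d) ℤ.* + c) (*-identityʳ c) ⟩
    (+ a ℤ.* + x ℤ.* + c ℤ.+ + k ℤ.* + c) ℤ.* + c
      ≡⟨ clear (+ a) (+ x) (+ c) (+ k) ⟩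
    (+ a ℤ.* + x ℤ.+ + k) ℤ.* (+ c ℤ.* + c)
      ≡⟨ cong₂ ℤ._*_ (cong (ℤ._+ + k) (ℤ.pos-* a x)) (ℤ.pos-* c c) ⟨
    + (a * x + k) ℤ.* + (c * c)
      ≡⟨ cong (λ d → + (a * x + k) ℤ.* + (d * c)) (*-identityʳ c) ⟨
    + (a * x + k) ℤ.* + (c * 1 * c) ∎)
    where
    open ≡-Reasoning
    clear : ∀ a x c k → (a ℤ.* x ℤ.* c ℤ.+ k ℤ.* c) ℤ.* c ≡ (a ℤ.* x ℤ.+ k) ℤ.* (c ℤ.* c)
    clear = ℤ-Ring.solve-∀

  rhs : toℚᵘ ((+ a / c) ℚ.* (+ x / 1) ℚ.+ (+ k / c)) ℚᵘ.≃ mkℚᵘ (+ (a * x + k)) c-1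
  rhs = ℚᵘ.≃-trans (ℚ.toℚᵘ-homo-+ ((+ a / c) ℚ.* (+ x / 1)) (+ k / c))
       (ℚᵘ.≃-trans (ℚᵘ.+-cong
          (ℚᵘ.≃-trans (ℚ.toℚᵘ-homo-* (+ a / c) (+ x / 1))
            (ℚᵘ.*-cong (ℚ.toℚᵘ-fromℚᵘ (mkℚᵘ (+ a) c-1)) (ℚ.toℚᵘ-fromℚᵘ (mkℚᵘ (+ x) 0))))
          (ℚ.toℚᵘ-fromℚᵘ (mkℚᵘ (+ k) c-1)))
        frac)

  cross : + y ℤ.* + c ≡ + (c * y)
  cross = trans (sym (ℤ.pos-* y c)) (cong +_ (*-comm y c))

  to : Below a c k (x , y) → c * y < a * x + k
  to lt with ℚᵘ.<-respʳ-≃ rhs (ℚᵘ.<-respˡ-≃ lhs (ℚ.toℚᵘ-mono-< lt))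
  ... | *<* lt′ = ℤ.drop‿+<+ (subst₂ ℤ._<_ cross (ℤ.*-identityʳ (+ (a * x + k))) lt′)

  from : c * y < a * x + k → Below a c k (x , y)
  from lt = ℚ.toℚᵘ-cancel-< (ℚᵘ.<-respʳ-≃ (ℚᵘ.≃-sym rhs) (ℚᵘ.<-respˡ-≃ (ℚᵘ.≃-sym lhs)
    (*<* (subst₂ ℤ._<_ (sym cross) (sym (ℤ.*-identityʳ (+ (a * x + k)))) (ℤ.+<+ lt)))))

-- Lets the evaluation stay in the natural numbers, with the quotient formed only at the end.
D*S≡T*X⇒S≡T/D*X : ∀ S T D X .{{_ : NonZero D}} → D * S ≡ T * X →
                  + S / 1 ≡ (+ T / D) ℚ.* (+ X / 1)
D*S≡T*X⇒S≡T/D*X S T D@(suc D-1) X eq = ℚ.toℚᵘ-injective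
  (ℚᵘ.≃-trans (ℚ.toℚᵘ-fromℚᵘ (mkℚᵘ (+ S) 0))
  (ℚᵘ.≃-trans (*≡* cross)
  (ℚᵘ.≃-sym (ℚᵘ.≃-trans (ℚ.toℚᵘ-homo-* (+ T / D) (+ X / 1))
     (ℚᵘ.*-cong (ℚ.toℚᵘ-fromℚᵘ (mkℚᵘ (+ T) D-1)) (ℚ.toℚᵘ-fromℚᵘ (mkℚᵘ (+ X) 0)))))))
  where
  cross : + S ℤ.* + (D * 1) ≡ (+ T ℤ.* + X) ℤ.* + 1
  cross = begin
    + S ℤ.* + (D * 1)       ≡⟨ ℤ.pos-* S (D * 1) ⟨
    + (S * (D * 1))         ≡⟨ cong +_ (trans (cong (S *_) (*-identityʳ D)) (trans (*-comm S D) eq)) ⟩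
    + (T * X)               ≡⟨ ℤ.pos-* T X ⟩
    + T ℤ.* + X             ≡⟨ ℤ.*-identityʳ _ ⟨
    (+ T ℤ.* + X) ℤ.* + 1   ∎
    where open ≡-Reasoning

-- Paths below the line and their heights

-- As `h ∸ a` is the maximum of 0 and h - a, the bound splits into one for the starting point and
-- one for the points after an East step.
u+[h∸a]<v⇔ : ∀ u h a v → u + (h ∸ a) < v ⇔ (u < v × u + h < a + v)
u+[h∸a]<v⇔ u h a v = mk⇔
  (λ lt → ≤-<-trans (m≤m+n u (h ∸ a)) lt , (begin-strict
    u + h             ≤⟨ +-monoʳ-≤ u (m≤n+m∸n h a) ⟩
    u + (a + (h ∸ a)) ≡⟨ swap u a (h ∸ a) ⟩
    a + (u + (h ∸ a)) <⟨ +-monoʳ-< a lt ⟩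
    a + v             ∎))
  from
  where
  open ≤-Reasoning
  swap : ∀ x y z → x + (y + z) ≡ y + (x + z)
  swap = solve-∀
  from : u < v × u + h < a + v → u + (h ∸ a) < v
  from (u<v , u+h<a+v) with ≤-total h a
  ... | inj₁ h≤a = subst (_< v) (sym (trans (cong (λ z → u + z) (m≤n⇒m∸n≡0 h≤a)) (+-identityʳ u))) u<v
  ... | inj₂ a≤h = +-cancelˡ-< a _ _ (subst (_< a + v)
    (trans (cong (λ z → u + z) (sym (m+[n∸m]≡n a≤h))) (swap u a (h ∸ a))) u+h<a+v)

-- The start is left general for the induction: `height` measures the largest rise of c y - a x
-- above its value there.
All-Below⇔height : ∀ a c k .{{_ : NonZero c}} x y w →
                   All (Below a c k) (points (x , y) w) ⇔ c * y + height a c 0 w < a * x + k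
All-Below⇔height a c k x y [] = mk⇔
  (λ { (b ∷ []) → subst (_< a * x + k) (sym (+-identityʳ (c * y))) (to (Below⇔ a c k x y) b) })
  (λ lt → from (Below⇔ a c k x y) (subst (_< a * x + k) (+-identityʳ (c * y)) lt) ∷ [])
  where open Equivalence
All-Below⇔height a c k x y (E ∷ w) = mk⇔
  (λ { (b ∷ bs) → from drop (to (Below⇔ a c k x y) b ,
                             subst (c * y + h <_) shift (to (All-Below⇔height a c k (suc x) y w) bs)) })
  (λ lt → let (b , bs) = to drop lt in
          from (Below⇔ a c k x y) b ∷
          from (All-Below⇔height a c k (suc x) y w) (subst (c * y + h <_) (sym shift) bs))
  where
  open Equivalence
  h = height a c 0 w
  drop = u+[h∸a]<v⇔ (c * y) h a (a * x + k)
  shift : a * suc x + k ≡ a + (a * x + k)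
  shift = trans (cong (_+ k) (*-suc a x)) (+-assoc a (a * x) k)
All-Below⇔height a c k x y (N ∷ w) = mk⇔
  (λ { (b ∷ bs) → subst (_< a * x + k) (regroup c y h) (to (All-Below⇔height a c k x (suc y) w) bs) })
  -- Before a North step the bound follows from the one after it, since `h` and `c` are nonnegative.
  (λ lt → from (Below⇔ a c k x y) (≤-<-trans (m≤m+n (c * y) (h + c)) lt) ∷
          from (All-Below⇔height a c k x (suc y) w) (subst (_< a * x + k) (sym (regroup c y h)) lt))
  where
  open Equivalence
  h = height a c 0 w
  regroup : ∀ c y h → c * suc y + h ≡ c * y + (h + c)
  regroup = solve-∀

-- Once the length is fixed, the number of North steps determines the endpoint.
IsPathBelow⇔ : ∀ a c k .{{_ : NonZero c}} x p w → length w ≡ x + p →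
               IsPathBelow a c k (x , p) w ⇔ (norths w ≡ p × height a c 0 w < k)
IsPathBelow⇔ a c k x p w l = mk⇔
  (λ (e , b) → cong proj₂ (trans (sym (end-coordinates 0 0 w)) e) ,
               subst₂ _<_ (cong (_+ h) (*-zeroʳ c)) (cong (_+ k) (*-zeroʳ a))
                 (to (All-Below⇔height a c k 0 0 w) b))
  (λ (n≡p , lt) → trans (end-coordinates 0 0 w) (cong₂ _,_ (easts≡x n≡p) n≡p) ,
               from (All-Below⇔height a c k 0 0 w)
                 (subst₂ _<_ (cong (_+ h) (sym (*-zeroʳ c))) (cong (_+ k) (sym (*-zeroʳ a))) lt))
  where
  open Equivalence
  h = height a c 0 w
  easts≡x : norths w ≡ p → easts w ≡ x
  easts≡x refl = +-cancelʳ-≡ (norths w) _ _ (trans (easts+norths≡length w) l)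

-- Counting paths and summing over `k`

length-pathsBelow : ∀ a c k .{{_ : NonZero c}} x p →
  length (pathsBelow a c k (x , p)) ≡ ∑ʷ (x + p) (λ w → χ p w * ⟦ does (height a c 0 w <? k) ⟧)
length-pathsBelow a c k x p = begin
  length (filter (isPathBelow? a c k (x , p)) (words (x + p)))
    ≡⟨ length-filter≡sum (isPathBelow? a c k (x , p)) (words (x + p)) ⟩
  sum (map (λ w → ⟦ does (isPathBelow? a c k (x , p) w) ⟧) (words (x + p)))
    ≡⟨ sum-map-words (x + p) _ ⟩
  ∑ʷ (x + p) (λ w → ⟦ does (isPathBelow? a c k (x , p) w) ⟧)
    ≡⟨ ∑ʷ-cong-length (x + p) (λ w l → trans
         (cong ⟦_⟧ (does-⇔ (IsPathBelow⇔ a c k x p w l) (isPathBelow? a c k (x , p) w)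
                           (norths w ≟ p ×-dec height a c 0 w <? k)))
         (⟦⟧-∧ (does (norths w ≟ p)) _)) ⟩
  ∑ʷ (x + p) (λ w → χ p w * ⟦ does (height a c 0 w <? k) ⟧) ∎
  where open ≡-Reasoning

∑-pathsBelow : ∀ a c ℓ .{{_ : NonZero c}} x p → ℓ * a ≤ c →
  ∑[ ℓ * a + 1 ⋯ (ℓ + 1) * a ] (λ k → length (pathsBelow a c k (x , p)))
  ≡ ∑ʷ (ℓ + (x + p)) (λ w → χ p w * (a ∸ height a c 0 w))
∑-pathsBelow a c ℓ x p ℓa≤c = begin
  sum (applyUpTo (λ i → length (pathsBelow a c (m + i) (x , p))) (suc ((ℓ + 1) * a) ∸ m))
    ≡⟨ cong (λ r → sum (applyUpTo (λ i → length (pathsBelow a c (m + i) (x , p))) r)) range ⟩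
  sum (applyUpTo (λ i → length (pathsBelow a c (m + i) (x , p))) a)
    ≡⟨ sum-applyUpTo-cong a (λ i → length-pathsBelow a c (m + i) x p) ⟩
  sum (applyUpTo (λ i → ∑ʷ L (λ w → χ p w * ⟦ does (h w <? m + i) ⟧)) a)
    ≡⟨ sum-applyUpTo-∑ʷ a L _ ⟩
  ∑ʷ L (λ w → sum (applyUpTo (λ i → χ p w * ⟦ does (h w <? m + i) ⟧) a))
    ≡⟨ ∑ʷ-cong L (λ w → trans (sum-applyUpTo-*ˡ a (χ p w) _)
                        (cong (χ p w *_) (trans (count-bounds (h w) m a) (cong (a ∸_) (pred² (h w)))))) ⟩
  ∑ʷ L (λ w → χ p w * (a ∸ (h w ∸ ℓ * a)))
    ≡⟨ ∑ʷ-prepend-E a c ℓ L p ℓa≤c ⟩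
  ∑ʷ (ℓ + L) (λ w → χ p w * (a ∸ h w)) ∎
  where
  open ≡-Reasoning
  m = ℓ * a + 1
  L = x + p
  h = height a c 0
  -- The `+ 1` in the first value of `k` cancels the successor from `count-bounds`.
  pred² : ∀ h → suc h ∸ m ≡ h ∸ ℓ * a
  pred² h = cong (suc h ∸_) (+-comm (ℓ * a) 1)
  split : ∀ ℓ a → suc ((ℓ + 1) * a) ≡ ℓ * a + 1 + a
  split = solve-∀
  range : suc ((ℓ + 1) * a) ∸ m ≡ a
  range = trans (cong (_∸ m) (split ℓ a)) (m+n∸m≡n m a)

-- The endpoint `(c * s ∸ 1 , a * s ∸ 1)`

theorem8p5 : (a c : ℕ) .{{_ : NonZero a}} .{{_ : NonZero c}} (a<c : a < c) (b : ℤ) → + a ∣ b →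
    (s ℓ : ℕ) .{{_ : NonZero s}} → (ℓ + 1) * a < c →
    let D = (a + c) * s + ℓ ∸ 1 in
    + (∑[ ℓ * a + 1 ⋯ (ℓ + 1) * a ] (A a c s)) / 1
    ≡ (_/_ (+ (ℓ * a + c)) D {{denominator-nonZero a c s ℓ a<c}}) ℚ.* (+ (D C (a * s ∸ 1)) / 1)
theorem8p5 a c a<c _ _ s ℓ [ℓ+1]a<c =
  D*S≡T*X⇒S≡T/D*X _ (ℓ * a + c) D (D C p) {{denominator-nonZero a c s ℓ a<c}} (begin
    D * (∑[ ℓ * a + 1 ⋯ (ℓ + 1) * a ] (A a c s))
      ≡⟨ cong (D *_) (∑-pathsBelow a c ℓ x p ℓa≤c) ⟩
    D * S
      ≡⟨ cong (_* S) D≡1+n ⟩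
    suc n * S
      -- The second count is `c * s + ℓ`, one East step more than in the words that contribute to
      -- `S`.
      ≡⟨ [1+n]*∑ʷ-gap a c n p (suc x + ℓ) (ℓ * a + c) (steps x p ℓ) aq≡cp+T ⟩
    (ℓ * a + c) * (suc n C p)
      ≡⟨ cong (λ d → (ℓ * a + c) * (d C p)) D≡1+n ⟨
    (ℓ * a + c) * (D C p) ∎)
  where
  open ≡-Reasoning
  D = (a + c) * s + ℓ ∸ 1
  x = c * s ∸ 1
  p = a * s ∸ 1
  n = ℓ + (x + p)
  S = ∑ʷ n (λ w → χ p w * (a ∸ height a c 0 w))

  -- Since `c` and `s` are positive, the truncated `∸ 1` is exact.
  1+x≡cs : suc x ≡ c * s
  1+x≡cs = m+[n∸m]≡n (>-nonZero⁻¹ (c * s) {{m*n≢0 c s}})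

  1+p≡as : suc p ≡ a * s
  1+p≡as = m+[n∸m]≡n (>-nonZero⁻¹ (a * s) {{m*n≢0 a s}})

  ℓa≤c : ℓ * a ≤ c
  ℓa≤c = ≤-trans (*-monoˡ-≤ a (m≤m+n ℓ 1)) (<⇒≤ [ℓ+1]a<c)

  steps : ∀ x p ℓ → p + (suc x + ℓ) ≡ suc (ℓ + (x + p))
  steps = solve-∀

  D≡1+n : D ≡ suc n
  D≡1+n = cong (_∸ 1) (begin
    (a + c) * s + ℓ     ≡⟨ cong (_+ ℓ) (*-distribʳ-+ s a c) ⟩
    a * s + c * s + ℓ   ≡⟨ cong₂ (λ u v → u + v + ℓ) 1+p≡as 1+x≡cs ⟨
    suc p + suc x + ℓ   ≡⟨ cong suc (trans (+-assoc p (suc x) ℓ) (steps x p ℓ)) ⟩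
    suc (suc n)         ∎)

  -- The surplus a (c s + ℓ) - c (a s - 1) = ℓ a + c is the numerator of the claim.
  aq≡cp+T : a * (suc x + ℓ) ≡ c * p + (ℓ * a + c)
  aq≡cp+T = begin
    a * (suc x + ℓ)         ≡⟨ cong (λ u → a * (u + ℓ)) 1+x≡cs ⟩
    a * (c * s + ℓ)         ≡⟨ exchange a c s ℓ ⟩
    c * (a * s) + ℓ * a     ≡⟨ cong (λ u → c * u + ℓ * a) 1+p≡as ⟨
    c * suc p + ℓ * a       ≡⟨ collect c p (ℓ * a) ⟩
    c * p + (ℓ * a + c)     ∎
    where
    exchange : ∀ a c s ℓ → a * (c * s + ℓ) ≡ c * (a * s) + ℓ * a
    exchange = solve-∀
    collect : ∀ c p t → c * suc p + t ≡ c * p + (t + c)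
    collect = solve-∀
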